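{- Let $f=(f_0,f_1,f_2,\dots)\in\{1,-1\}^{\mathbb{N}}$ be a folding instruction sequence. Then $A_f(n)=4\cdot\phi(n)+n-1$ for all $n\ge7$ if and only if $f=(f_0,f_1,f_2,f_3,1,-1,1,-1,\dots)$ or $f=(f_0,f_1,f_2,f_3,-1,1,-1,1,\dots)$ (i.e. $f_{i+1}=-f_i$ for all $i\ge4$), with $f_0,f_1,f_2,f_3\in\{ -1,1\}$ arbitrary. Likewise, $A_f(n)=6\cdot\phi(n)+n-1$ for all $n\ge 7$ if and only if $f=(f_0,f_1,f_2,f_3,1,1,1,\dots)$ or $f=(f_0,f_1,f_2,f_3,-1,-1,-1,\dots)$ (i.e. $f_i=f_4$ for all $i\ge4$), with $f_0,f_1,f_2,f_3\in\{ -1,1\}$ arbitrary.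
   Context: A folding instruction sequence is an infinite sequence $f=(f_0,f_1,\dots)$ with each $f_i\in\{1,-1\}$ (indexed from $0$). The paper-folding sequence $P_f=P_f[1],P_f[2],\dots$ is defined by: for $m\ge1$ write $m=2^s r$ with $r$ odd; $P_f[m]=f_s$ if $r\equiv 1\pmod 4$ and $P_f[m]=-f_s$ if $r\equiv3\pmod4$. $P_f[i:j]$ denotes $P_f[i]\cdots P_f[j]$. A length-$n$ factor of $P_f$ is a word of the form $P_f[i:i+n-1]$, $i\ge1$. The appearance function $A_f(n)$ is the least integer $K$ such that every length-$n$ factor of $P_f$ occurs as a subword of the prefix $P_f[1:K]$. $\phi(n)$ is the least power of $2$ that is $\ge n$. -}

module Defs where

open import Data.Nat using (ℕ; zero; suc; _+_; _*_; _∸_; _≤_; _≤ᵇ_)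
open import Data.Nat.DivMod using (_/_; _%_)
open import Data.Bool using (if_then_else_)
open import Data.Product using (_×_; _,_; proj₁; proj₂; Σ; ∃)
open import Data.List using (List; map; upTo)
open import Data.Sign using (Sign; opposite)
open import Relation.Binary.PropositionalEquality using (_≡_)

-- A folding instruction sequence f = (f₀, f₁, …), each fᵢ ∈ {1,-1}
-- (Sign.+ represents 1, Sign.- represents -1).
FoldingSeq : Set
FoldingSeq = ℕ → Sign

-- 2-adic decomposition m = 2^s * r with r odd (for m ≥ 1), computed with
-- fuel (fuel m suffices).  Returns (s , r).
decomp′ : ℕ → ℕ → ℕ × ℕ
decomp′ zero    m = 0 , m
decomp′ (suc k) zero = 0 , 0
decomp′ (suc k) m with m % 2
... | zero  = let p = decomp′ k (m / 2) in suc (proj₁ p) , proj₂ p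
... | suc _ = 0 , m

decomp : ℕ → ℕ × ℕ
decomp m = decomp′ m m

-- Paper-folding sequence P_f[m] (meaningful for m ≥ 1; P_f[0] is junk):
-- m = 2^s r, r odd; P_f[m] = f_s if r ≡ 1 (mod 4), -f_s if r ≡ 3 (mod 4).
P : FoldingSeq → ℕ → Sign
P f m with decomp m
... | s , r = if r % 4 ≤ᵇ 1 then f s else opposite (f s)

-- The word P_f[i : i+n-1] (length n, starting at position i).
factorAt : FoldingSeq → ℕ → ℕ → List Sign
factorAt f i n = map (λ k → P f (i + k)) (upTo n)

-- The word w (of length n) occurs as a subword of the prefix P_f[1:K].
OccursInPrefix : FoldingSeq → ℕ → ℕ → List Sign → Set
OccursInPrefix f K n w =
  Σ ℕ λ j → (1 ≤ j) × (j + n ∸ 1 ≤ K) × (factorAt f j n ≡ w)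

-- Every length-n factor of P_f occurs in P_f[1:K].
AllFactorsIn : FoldingSeq → ℕ → ℕ → Set
AllFactorsIn f n K = ∀ i → 1 ≤ i → OccursInPrefix f K n (factorAt f i n)

-- "A_f(n) = K": K is the least integer such that every length-n factor
-- of P_f occurs in P_f[1:K].
AppearanceIs : FoldingSeq → ℕ → ℕ → Set
AppearanceIs f n K = AllFactorsIn f n K × (∀ K′ → AllFactorsIn f n K′ → K ≤ K′)

-- φ(n): the least power of 2 that is ≥ n.  Search over 1, 2, 4, … with fuel.
phiSearch : ℕ → ℕ → ℕ → ℕ
phiSearch zero    p n = p
phiSearch (suc k) p n = if n ≤ᵇ p then p else phiSearch k (2 * p) n

φ : ℕ → ℕ
φ n = phiSearch n 1 n

-- Let N = φ(n) = 2^(k+1), so 2^k < n ≤ N.  Away from the multiples of 2^k the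
-- sequence P_f has period 2N, so a window of length n is determined by its offset
-- modulo N together with the one letter it meets at a multiple N·t, namely
-- P_g[t] for g = (f_{k+1}, f_{k+2}, …).  Every letter of P_g already occurs at
-- some t ≤ 6 of the right parity, and at some t ≤ 4 when f_{k+2} ≠ f_{k+3};
-- hence A_f(n) ≤ c·N + n − 1 with c = 4 or 6.  Conversely the window starting at
-- c·N is new: an earlier occurrence j would be a period of P_f[1 : n−1], which
-- forces j = 2N·t with 1 ≤ t < c/2 and then P_{g′}[t] = P_{g′}[c/2] for
-- g′ = (f_{k+2}, f_{k+3}, …); but in either case the letter at c/2 is the first
-- of its value in P_{g′}.  As n ≥ 7 means k ≥ 2, the two formulas read off
-- f_i ≠ f_{i+1} or f_i = f_{i+1} for each i ≥ 4.
module Submission where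

open import Defs
open import Data.Bool using (true; false; T; if_then_else_)
open import Data.Empty using (⊥-elim)
open import Data.List using (applyUpTo; _∷_)
open import Data.List.Properties using (map-applyUpTo; ∷-injectiveˡ; ∷-injectiveʳ)
open import Data.Nat using (ℕ; zero; suc; _+_; _*_; _∸_; _^_; _≤_; _<_; _≤ᵇ_; z≤n; s≤s; NonZero)
open import Data.Nat.DivMod using (_%_; _/_; [m+kn]%n≡m%n; m*n%n≡0; m*n/n≡m; m/n<m; m%n<n; m≡m%n+[m/n]*n)
open import Data.Nat.Properties
open import Data.Nat.Tactic.RingSolver using (solve-∀)
open import Data.Product using (_×_; _,_; proj₁; proj₂; map₁; ∃; ∃₂)
open import Data.Sign using (Sign; opposite)
open import Data.Sign.Properties using (s≢opposite[s]) renaming (_≟_ to _≟ˢ_)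
open import Data.Sum using (_⊎_; inj₁; inj₂)
open import Data.Unit using (tt)
open import Function.Bundles using (_⇔_; mk⇔; Equivalence)
open import Function.Construct.Composition using (_⇔-∘_)
open import Function.Construct.Symmetry using (⇔-sym)
open import Relation.Binary using (tri<; tri≈; tri>)
open import Relation.Binary.PropositionalEquality
open import Relation.Nullary using (¬_; yes; no)

data Parity : ℕ → Set where
  even : ∀ h → Parity (2 * h)
  odd  : ∀ h → Parity (suc (2 * h))

parity : ∀ n → Parity n
parity zero = even 0
parity (suc n) with parity n
... | even h = odd h
... | odd h  = subst Parity (cong suc (+-suc h (h + 0))) (even (suc h))

letter : FoldingSeq → ℕ × ℕ → Sign
letter f p = if proj₂ p % 4 ≤ᵇ 1 then f (proj₁ p) else opposite (f (proj₁ p))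

P≡letter∘decomp : ∀ f m → P f m ≡ letter f (decomp m)
P≡letter∘decomp f m with decomp m
... | s , r = refl

decomp′-fuel : ∀ {k k′} m → m ≤ k → m ≤ k′ → decomp′ k m ≡ decomp′ k′ m
decomp′-fuel {zero}  {zero}   zero _ _ = refl
decomp′-fuel {zero}  {suc _}  zero _ _ = refl
decomp′-fuel {suc _} {zero}   zero _ _ = refl
decomp′-fuel {suc _} {suc _}  zero _ _ = refl
decomp′-fuel {suc k} {suc k′} (suc m) (s≤s m≤k) (s≤s m≤k′) with suc m % 2
... | zero  = cong (map₁ suc) (decomp′-fuel (suc m / 2) (half≤ m≤k) (half≤ m≤k′))
  where
  half≤ : ∀ {x} → m ≤ x → suc m / 2 ≤ x
  half≤ = ≤-trans (≤-pred (m/n<m (suc m) 2 (s≤s (s≤s z≤n))))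
... | suc _ = refl

decomp′-odd : ∀ k m → suc m % 2 ≡ 1 → decomp′ (suc k) (suc m) ≡ (0 , suc m)
decomp′-odd k m m%2≡1 with suc m % 2 | m%2≡1
... | .1 | refl = refl

decomp′-even : ∀ k m → suc m % 2 ≡ 0 → decomp′ (suc k) (suc m) ≡ map₁ suc (decomp′ k (suc m / 2))
decomp′-even k m m%2≡0 with suc m % 2 | m%2≡0
... | .0 | refl = refl

decomp-double : ∀ a → decomp (2 * suc a) ≡ map₁ suc (decomp (suc a))
decomp-double a = begin
    decomp′ (suc m) (suc m)
  ≡⟨ decomp′-even m m (trans (cong (_% 2) 2a≡a2) (m*n%n≡0 (suc a) 2)) ⟩
    map₁ suc (decomp′ m (suc m / 2))
  ≡⟨ cong (λ x → map₁ suc (decomp′ m x)) (trans (cong (_/ 2) 2a≡a2) (m*n/n≡m (suc a) 2)) ⟩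
    map₁ suc (decomp′ m (suc a))
  ≡⟨ cong (map₁ suc) (decomp′-fuel (suc a) 1+a≤m ≤-refl) ⟩
    map₁ suc (decomp (suc a))
  ∎
  where
  open ≡-Reasoning
  -- 2 * suc a reduces to suc m
  m = a + suc (a + 0)
  1+a≤m : suc a ≤ m
  1+a≤m = subst (suc a ≤_) (sym (+-suc a (a + 0))) (s≤s (m≤m+n a (a + 0)))
  2a≡a2 : 2 * suc a ≡ suc a * 2
  2a≡a2 = *-comm 2 (suc a)

shift : ℕ → FoldingSeq → FoldingSeq
shift k f i = f (k + i)

shift-comm : ∀ k f i → shift k f i ≡ f (i + k)
shift-comm k f i = cong f (+-comm k i)

P-even : ∀ f {a} → 1 ≤ a → P f (2 * a) ≡ P (shift 1 f) a
P-even f {suc a} _ = begin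
    P f (2 * suc a)                      ≡⟨ P≡letter∘decomp f (2 * suc a) ⟩
    letter f (decomp (2 * suc a))        ≡⟨ cong (letter f) (decomp-double a) ⟩
    letter (shift 1 f) (decomp (suc a))  ≡⟨ sym (P≡letter∘decomp (shift 1 f) (suc a)) ⟩
    P (shift 1 f) (suc a)                ∎
  where open ≡-Reasoning

P-odd : ∀ f m → suc m % 2 ≡ 1 → P f (suc m) ≡ letter f (0 , suc m)
P-odd f m m%2≡1 = trans (P≡letter∘decomp f (suc m)) (cong (letter f) (decomp′-odd m m m%2≡1))

[r+4c]%2≡r%2 : ∀ r c → (r + 4 * c) % 2 ≡ r % 2
[r+4c]%2≡r%2 r c = trans (cong (λ x → (r + x) % 2) (trans (*-assoc 2 2 c) (*-comm 2 (2 * c)))) ([m+kn]%n≡m%n r (2 * c) 2)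

[r+4c]%4≡r%4 : ∀ r c → (r + 4 * c) % 4 ≡ r % 4
[r+4c]%4≡r%4 r c = trans (cong (λ x → (r + x) % 4) (*-comm 4 c)) ([m+kn]%n≡m%n r c 4)

P-1+4c : ∀ f c → P f (1 + 4 * c) ≡ f 0
P-1+4c f c = trans (P-odd f (4 * c) ([r+4c]%2≡r%2 1 c))
                   (cong (λ r → if r ≤ᵇ 1 then f 0 else opposite (f 0)) ([r+4c]%4≡r%4 1 c))

P-3+4c : ∀ f c → P f (3 + 4 * c) ≡ opposite (f 0)
P-3+4c f c = trans (P-odd f (2 + 4 * c) ([r+4c]%2≡r%2 3 c))
                   (cong (λ r → if r ≤ᵇ 1 then f 0 else opposite (f 0)) ([r+4c]%4≡r%4 3 c))

P-odd-periodic : ∀ f x h → P f (4 * x + suc (2 * h)) ≡ P f (suc (2 * h))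
P-odd-periodic f x h with parity h
... | even c = begin
    P f (4 * x + suc (2 * (2 * c))) ≡⟨ cong (P f) (shift-1mod4 x c) ⟩
    P f (suc (4 * (x + c)))         ≡⟨ P-1+4c f (x + c) ⟩
    f 0                             ≡⟨ sym (P-1+4c f c) ⟩
    P f (suc (4 * c))               ≡⟨ cong (P f) (cong suc (*-assoc 2 2 c)) ⟩
    P f (suc (2 * (2 * c)))         ∎
  where
  open ≡-Reasoning
  shift-1mod4 : ∀ x c → 4 * x + suc (2 * (2 * c)) ≡ suc (4 * (x + c))
  shift-1mod4 = solve-∀
... | odd c = begin
    P f (4 * x + suc (2 * suc (2 * c))) ≡⟨ cong (P f) (shift-3mod4 x c) ⟩
    P f (3 + 4 * (x + c))               ≡⟨ P-3+4c f (x + c) ⟩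
    opposite (f 0)                      ≡⟨ sym (P-3+4c f c) ⟩
    P f (3 + 4 * c)                     ≡⟨ cong (P f) (3+4c c) ⟩
    P f (suc (2 * suc (2 * c)))         ∎
  where
  open ≡-Reasoning
  shift-3mod4 : ∀ x c → 4 * x + suc (2 * suc (2 * c)) ≡ 3 + 4 * (x + c)
  shift-3mod4 = solve-∀
  3+4c : ∀ c → 3 + 4 * c ≡ suc (2 * suc (2 * c))
  3+4c = solve-∀

P-2^k* : ∀ k f {q} → 1 ≤ q → P f (2 ^ k * q) ≡ P (shift k f) q
P-2^k* zero    f {q} _   = cong (P f) (+-identityʳ q)
P-2^k* (suc k) f {q} q≥1 = begin
    P f (2 * 2 ^ k * q)           ≡⟨ cong (P f) (*-assoc 2 (2 ^ k) q) ⟩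
    P f (2 * (2 ^ k * q))         ≡⟨ P-even f (*-mono-≤ (m^n>0 2 k) q≥1) ⟩
    P (shift 1 f) (2 ^ k * q)     ≡⟨ P-2^k* k (shift 1 f) q≥1 ⟩
    P (shift (suc k) f) q         ∎
  where open ≡-Reasoning

P-periodic : ∀ k f e q s → 1 ≤ s → s < 2 ^ k →
             P f (2 ^ suc k * e + (2 ^ k * q + s)) ≡ P f (2 ^ k * q + s)
P-periodic zero    f e q (suc s) _ (s≤s ())
P-periodic (suc k) f e q s s≥1 s<2^k+1 with parity s
... | even h = begin
    P f (2 * (2 * N) * e + (2 * N * q + 2 * h))  ≡⟨ cong (P f) (even-split N e q h) ⟩
    P f (2 * (2 * N * e + (N * q + h)))          ≡⟨ P-even f (≤-trans h≥1 (≤-trans (m≤n+m h (N * q)) (m≤n+m _ (2 * N * e)))) ⟩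
    P (shift 1 f) (2 * N * e + (N * q + h))      ≡⟨ P-periodic k (shift 1 f) e q h h≥1 (*-cancelˡ-< 2 h N s<2^k+1) ⟩
    P (shift 1 f) (N * q + h)                    ≡⟨ sym (P-even f (≤-trans h≥1 (m≤n+m h (N * q)))) ⟩
    P f (2 * (N * q + h))                        ≡⟨ cong (P f) (sym (even-merge N q h)) ⟩
    P f (2 * N * q + 2 * h)                      ∎
  where
  open ≡-Reasoning
  N = 2 ^ k
  h≥1 : 1 ≤ h
  h≥1 = half-pos h s≥1
    where
    half-pos : ∀ h → 1 ≤ 2 * h → 1 ≤ h
    half-pos (suc h) _ = s≤s z≤n
  even-split : ∀ N e q h → 2 * (2 * N) * e + (2 * N * q + 2 * h) ≡ 2 * (2 * N * e + (N * q + h))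
  even-split = solve-∀
  even-merge : ∀ N q h → 2 * N * q + 2 * h ≡ 2 * (N * q + h)
  even-merge = solve-∀
... | odd h = begin
    P f (2 * (2 * N) * e + (2 * N * q + suc (2 * h)))  ≡⟨ cong (P f) (odd-split N e q h) ⟩
    P f (4 * (N * e) + suc (2 * (N * q + h)))          ≡⟨ P-odd-periodic f (N * e) (N * q + h) ⟩
    P f (suc (2 * (N * q + h)))                        ≡⟨ cong (P f) (sym (odd-merge N q h)) ⟩
    P f (2 * N * q + suc (2 * h))                      ∎
  where
  open ≡-Reasoning
  N = 2 ^ k
  odd-split : ∀ N e q h → 2 * (2 * N) * e + (2 * N * q + suc (2 * h)) ≡ 4 * (N * e) + suc (2 * (N * q + h))
  odd-split = solve-∀
  odd-merge : ∀ N q h → 2 * N * q + suc (2 * h) ≡ suc (2 * (N * q + h))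
  odd-merge = solve-∀

P-periodic-block : ∀ k f e q z → 1 ≤ z → z < 2 ^ suc k →
                   P (shift k f) (suc q + 2 * e) ≡ P (shift k f) (suc q) →
                   P f (2 ^ suc k * e + (2 ^ k * q + z)) ≡ P f (2 ^ k * q + z)
P-periodic-block k f e q z z≥1 z<2N same with <-cmp z (2 ^ k)
... | tri< z<N _ _ = P-periodic k f e q z z≥1 z<N
... | tri≈ _ refl _ = begin
    P f (2 * N * e + (N * q + N))  ≡⟨ cong (P f) (block-end N e q) ⟩
    P f (N * (suc q + 2 * e))      ≡⟨ P-2^k* k f (s≤s z≤n) ⟩
    P (shift k f) (suc q + 2 * e)  ≡⟨ same ⟩
    P (shift k f) (suc q)          ≡⟨ sym (P-2^k* k f (s≤s z≤n)) ⟩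
    P f (N * suc q)                ≡⟨ cong (P f) (trans (*-suc N q) (+-comm N (N * q))) ⟩
    P f (N * q + N)                ∎
  where
  open ≡-Reasoning
  N = 2 ^ k
  block-end : ∀ N e q → 2 * N * e + (N * q + N) ≡ N * (suc q + 2 * e)
  block-end = solve-∀
... | tri> _ _ N<z with z ∸ 2 ^ k | m+[n∸m]≡n (<⇒≤ N<z)
...   | s | refl = begin
    P f (2 * N * e + (N * q + (N + s)))  ≡⟨ cong (λ x → P f (2 * N * e + x)) (next-block N q s) ⟩
    P f (2 * N * e + (N * suc q + s))    ≡⟨ P-periodic k f e (suc q) s s≥1 s<N ⟩
    P f (N * suc q + s)                  ≡⟨ cong (P f) (sym (next-block N q s)) ⟩
    P f (N * q + (N + s))                ∎
  where
  open ≡-Reasoning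
  N = 2 ^ k
  s≥1 : 1 ≤ s
  s≥1 = +-cancelˡ-< N 0 s (subst (_< N + s) (sym (+-identityʳ N)) N<z)
  s<N : s < N
  s<N = +-cancelˡ-< N s N (subst (N + s <_) (cong (N +_) (+-identityʳ N)) z<2N)
  next-block : ∀ N q s → N * q + (N + s) ≡ N * suc q + s
  next-block = solve-∀

applyUpTo-≡⇔ : ∀ {A : Set} (u v : ℕ → A) n → applyUpTo u n ≡ applyUpTo v n ⇔ (∀ d → d < n → u d ≡ v d)
applyUpTo-≡⇔ u v n = mk⇔ (≡⇒pointwise u v n) (pointwise⇒≡ u v n)
  where
  ≡⇒pointwise : ∀ u v n → applyUpTo u n ≡ applyUpTo v n → ∀ d → d < n → u d ≡ v d
  ≡⇒pointwise u v (suc n) eq zero    _         = ∷-injectiveˡ eq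
  ≡⇒pointwise u v (suc n) eq (suc d) (s≤s d<n) = ≡⇒pointwise (λ x → u (suc x)) (λ x → v (suc x)) n (∷-injectiveʳ eq) d d<n
  pointwise⇒≡ : ∀ u v n → (∀ d → d < n → u d ≡ v d) → applyUpTo u n ≡ applyUpTo v n
  pointwise⇒≡ u v zero    _  = refl
  pointwise⇒≡ u v (suc n) eq = cong₂ _∷_ (eq 0 (s≤s z≤n)) (pointwise⇒≡ (λ x → u (suc x)) (λ x → v (suc x)) n (λ d d<n → eq (suc d) (s≤s d<n)))

factorAt-≡⇔ : ∀ f i j n → factorAt f i n ≡ factorAt f j n ⇔ (∀ d → d < n → P f (i + d) ≡ P f (j + d))
factorAt-≡⇔ f i j n = subst₂ (λ x y → x ≡ y ⇔ (∀ d → d < n → P f (i + d) ≡ P f (j + d)))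
  (sym (map-applyUpTo (λ d → d) (λ d → P f (i + d)) n))
  (sym (map-applyUpTo (λ d → d) (λ d → P f (j + d)) n))
  (applyUpTo-≡⇔ (λ d → P f (i + d)) (λ d → P f (j + d)) n)

≢⇒≡opposite : ∀ {x y : Sign} → ¬ x ≡ y → y ≡ opposite x
≢⇒≡opposite {Sign.-} {Sign.-} x≢y = ⊥-elim (x≢y refl)
≢⇒≡opposite {Sign.-} {Sign.+} _   = refl
≢⇒≡opposite {Sign.+} {Sign.-} _   = refl
≢⇒≡opposite {Sign.+} {Sign.+} x≢y = ⊥-elim (x≢y refl)

EveryLetterWithin : FoldingSeq → ℕ → Set
EveryLetterWithin g c = ∀ Q → 1 ≤ Q →
  ∃₂ λ Q′ e → 1 ≤ Q′ × Q′ ≤ c × Q ≡ Q′ + 2 * e × P g Q ≡ P g Q′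

-- As Sign has two values, odd positions show g 0 (at 1) or its opposite (at 3), and even
-- positions show g 1 (at 2) or its opposite (at 6, or at 4 when g 2 is that opposite).
everyLetterWithin : ∀ g c → 4 ≤ c → 6 ≤ c ⊎ g 2 ≡ opposite (g 1) → EveryLetterWithin g c
everyLetterWithin g c c≥4 -g1-within Q Q≥1 with parity Q
... | odd zero = 1 , 0 , ≤-refl , ≤-trans (m≤m+n 1 3) c≥4 , refl , refl
... | odd (suc b) with g 0 ≟ˢ P g Q
...   | yes g0≡x = 1 , suc b , ≤-refl , ≤-trans (m≤m+n 1 3) c≥4 , refl , sym g0≡x
...   | no  g0≢x = 3 , b , s≤s z≤n , ≤-trans (m≤m+n 3 1) c≥4 , cong suc (*-distribˡ-+ 2 1 b) , ≢⇒≡opposite g0≢x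
everyLetterWithin g c c≥4 -g1-within Q Q≥1 | even 1 = 2 , 0 , s≤s z≤n , ≤-trans (m≤m+n 2 2) c≥4 , refl , refl
everyLetterWithin g c c≥4 -g1-within Q Q≥1 | even 2 = 4 , 0 , s≤s z≤n , c≥4 , refl , refl
everyLetterWithin g c c≥4 -g1-within Q Q≥1 | even (suc (suc (suc b))) with g 1 ≟ˢ P g Q | -g1-within
... | yes g1≡x | _ = 2 , 2 + b , s≤s z≤n , ≤-trans (m≤m+n 2 2) c≥4 , *-distribˡ-+ 2 1 (2 + b) , sym g1≡x
... | no  g1≢x | inj₁ c≥6 = 6 , b , s≤s z≤n , c≥6 , *-distribˡ-+ 2 3 b , ≢⇒≡opposite g1≢x
... | no  g1≢x | inj₂ g2≡-g1 = 4 , 1 + b , s≤s z≤n , c≥4 , *-distribˡ-+ 2 2 (1 + b) , trans (≢⇒≡opposite g1≢x) (sym g2≡-g1)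

module _ (f : FoldingSeq) (k : ℕ) where
  private instance
    2^[1+k]≢0 : NonZero (2 ^ suc k)
    2^[1+k]≢0 = m^n≢0 2 (suc k)

  appearance-upper : ∀ n c → n ≤ 2 ^ suc k → EveryLetterWithin (shift (suc k) f) c →
                     AllFactorsIn f n (c * 2 ^ suc k + n ∸ 1)
  appearance-upper n c n≤N within (suc i) _
    with i / 2 ^ suc k | i % 2 ^ suc k | m≡m%n+[m/n]*n i (2 ^ suc k) | m%n<n i (2 ^ suc k)
  ... | u | w | refl | w<N with within (suc u) (s≤s z≤n)
  ... | suc q , e , _ , q<c , refl , same =
    N * q + suc w , ≤-trans (s≤s z≤n) (m≤n+m (suc w) (N * q)) , ∸-monoˡ-≤ 1 (+-monoˡ-≤ n start≤cN) ,
    Equivalence.from (factorAt-≡⇔ f (N * q + suc w) (suc (w + (q + 2 * e) * N)) n) window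
    where
    N = 2 ^ suc k
    start≤cN : N * q + suc w ≤ c * N
    start≤cN = begin
      N * q + suc w  ≤⟨ +-monoʳ-≤ (N * q) w<N ⟩
      N * q + N      ≡⟨ trans (+-comm (N * q) N) (sym (*-suc N q)) ⟩
      N * suc q      ≤⟨ *-monoʳ-≤ N q<c ⟩
      N * c          ≡⟨ *-comm N c ⟩
      c * N          ∎
      where open ≤-Reasoning
    window : ∀ d → d < n → P f (N * q + suc w + d) ≡ P f (suc (w + (q + 2 * e) * N) + d)
    window d d<n = begin
      P f (N * q + suc w + d)                  ≡⟨ cong (P f) (+-assoc (N * q) (suc w) d) ⟩
      P f (N * q + suc (w + d))                ≡⟨ sym (P-periodic-block (suc k) f e q (suc (w + d)) (s≤s z≤n) w+d<2N same) ⟩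
      P f (2 * N * e + (N * q + suc (w + d)))  ≡⟨ cong (P f) (block-sum N e q w d) ⟩
      P f (suc (w + (q + 2 * e) * N) + d)      ∎
      where
      open ≡-Reasoning
      w+d<2N : suc (w + d) < 2 * N
      w+d<2N = subst (suc (w + d) <_) (cong (N +_) (sym (+-identityʳ N))) (+-mono-≤-< w<N (<-≤-trans d<n n≤N))
      block-sum : ∀ N e q w d → 2 * N * e + (N * q + suc (w + d)) ≡ suc (w + (q + 2 * e) * N) + d
      block-sum = solve-∀

-- For odd j the positions j + 2 and j + 6 are odd and 4 apart, but P f 2 ≢ P f 6.
prefix-period⇒even : ∀ f j → P f (j + 2) ≡ P f 2 → P f (j + 6) ≡ P f 6 → ∃ λ h → j ≡ 2 * h
prefix-period⇒even f j at2 at6 with parity j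
... | even h = h , refl
... | odd c  = ⊥-elim (s≢opposite[s] (f 1) (begin
    f 1                              ≡⟨ sym at2 ⟩
    P f (suc (2 * c) + 2)            ≡⟨ cong (P f) (+2 c) ⟩
    P f (suc (2 * (c + 1)))          ≡⟨ sym (P-odd-periodic f 1 (c + 1)) ⟩
    P f (4 * 1 + suc (2 * (c + 1)))  ≡⟨ cong (P f) (+6 c) ⟩
    P f (suc (2 * c) + 6)            ≡⟨ at6 ⟩
    opposite (f 1)                   ∎))
  where
  open ≡-Reasoning
  +2 : ∀ c → suc (2 * c) + 2 ≡ suc (2 * (c + 1))
  +2 = solve-∀
  +6 : ∀ c → 4 * 1 + suc (2 * (c + 1)) ≡ suc (2 * c) + 6
  +6 = solve-∀

prefix-period⇒multiple-2^ : ∀ m f h → (∀ d → 1 ≤ d → d ≤ 2 ^ m → P f (2 * h + d) ≡ P f d) →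
                            ∃ λ t → 2 * h ≡ 2 ^ suc (suc m) * t
prefix-period⇒multiple-2^ m f h period with parity h
... | odd c = ⊥-elim (s≢opposite[s] (f 0) (begin
    f 0                       ≡⟨ sym (period 1 ≤-refl (m^n>0 2 m)) ⟩
    P f (2 * suc (2 * c) + 1) ≡⟨ cong (P f) (3mod4 c) ⟩
    P f (3 + 4 * c)           ≡⟨ P-3+4c f c ⟩
    opposite (f 0)            ∎))
  where
  open ≡-Reasoning
  3mod4 : ∀ c → 2 * suc (2 * c) + 1 ≡ 3 + 4 * c
  3mod4 = solve-∀
prefix-period⇒multiple-2^ zero    f h period | even c = c , sym (*-assoc 2 2 c)
prefix-period⇒multiple-2^ (suc m) f h period | even c
  with prefix-period⇒multiple-2^ m (shift 1 f) c halved-period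
  where
  halved-period : ∀ d → 1 ≤ d → d ≤ 2 ^ m → P (shift 1 f) (2 * c + d) ≡ P (shift 1 f) d
  halved-period d d≥1 d≤2^m = begin
    P (shift 1 f) (2 * c + d)    ≡⟨ sym (P-even f (≤-trans d≥1 (m≤n+m d (2 * c)))) ⟩
    P f (2 * (2 * c + d))        ≡⟨ cong (P f) (*-distribˡ-+ 2 (2 * c) d) ⟩
    P f (2 * (2 * c) + 2 * d)    ≡⟨ period (2 * d) (≤-trans d≥1 (m≤m+n d (d + 0))) (*-monoʳ-≤ 2 d≤2^m) ⟩
    P f (2 * d)                  ≡⟨ P-even f d≥1 ⟩
    P (shift 1 f) d              ∎
    where open ≡-Reasoning
... | t , 2c≡ = t , trans (cong (2 *_) 2c≡) (sym (*-assoc 2 (2 ^ suc (suc m)) t))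

prefix-period⇒multiple : ∀ k f n j → 7 ≤ n → 2 ^ k < n →
                         (∀ d → 1 ≤ d → d < n → P f (j + d) ≡ P f d) → ∃ λ t → j ≡ 2 ^ suc (suc k) * t
prefix-period⇒multiple k f n j n≥7 2^k<n period
  with prefix-period⇒even f j (period 2 (s≤s z≤n) (≤-trans (m≤m+n 3 4) n≥7)) (period 6 (s≤s z≤n) n≥7)
... | h , refl = prefix-period⇒multiple-2^ k f h (λ d d≥1 d≤2^k → period d d≥1 (≤-<-trans d≤2^k 2^k<n))

NewLetterAt : FoldingSeq → ℕ → Set
NewLetterAt g c = ∀ t → 1 ≤ t → t < c → ¬ P g t ≡ P g c

newLetterAt-2 : ∀ g → ¬ g 0 ≡ g 1 → NewLetterAt g 2
newLetterAt-2 g g0≢g1 1 _ _ = g0≢g1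
newLetterAt-2 g g0≢g1 (suc (suc _)) _ (s≤s (s≤s ()))

newLetterAt-3 : ∀ g → g 0 ≡ g 1 → NewLetterAt g 3
newLetterAt-3 g g0≡g1 1 _ _ = s≢opposite[s] (g 0)
newLetterAt-3 g g0≡g1 2 _ _ = λ g1≡-g0 → s≢opposite[s] (g 0) (trans g0≡g1 g1≡-g0)
newLetterAt-3 g g0≡g1 (suc (suc (suc _))) _ (s≤s (s≤s (s≤s ())))

no-early-occurrence : ∀ f k n c j → 7 ≤ n → 2 ^ k < n → n ≤ 2 ^ suc k → NewLetterAt (shift (2 + k) f) c →
                      1 ≤ j → j < 2 * c * 2 ^ suc k → ¬ factorAt f j n ≡ factorAt f (2 * c * 2 ^ suc k) n
no-early-occurrence f k n c j n≥7 2^k<n n≤N new j≥1 j<2cN same = new t t≥1 t<c same-letter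
  where
  N = 2 ^ suc k
  agree : ∀ d → d < n → P f (j + d) ≡ P f (2 * c * N + d)
  agree = Equivalence.to (factorAt-≡⇔ f j (2 * c * N) n) same
  period : ∀ d → 1 ≤ d → d < n → P f (j + d) ≡ P f d
  period d d≥1 d<n = begin
    P f (j + d)                    ≡⟨ agree d d<n ⟩
    P f (2 * c * N + d)            ≡⟨ cong (P f) (skip-blocks N c d) ⟩
    P f (2 * N * c + (N * 0 + d))  ≡⟨ P-periodic (suc k) f c 0 d d≥1 (<-≤-trans d<n n≤N) ⟩
    P f (N * 0 + d)                ≡⟨ cong (λ x → P f (x + d)) (*-zeroʳ N) ⟩
    P f d                          ∎
    where
    open ≡-Reasoning
    skip-blocks : ∀ N c d → 2 * c * N + d ≡ 2 * N * c + (N * 0 + d)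
    skip-blocks = solve-∀
  multiple : ∃ λ t → j ≡ 2 * N * t
  multiple = prefix-period⇒multiple k f n j n≥7 2^k<n period
  t = proj₁ multiple
  j≡2Nt : j ≡ 2 * N * t
  j≡2Nt = proj₂ multiple
  2cN≡2Nc : 2 * c * N ≡ 2 * N * c
  2cN≡2Nc = trans (*-assoc 2 c N) (trans (cong (2 *_) (*-comm c N)) (sym (*-assoc 2 N c)))
  t≥1 : 1 ≤ t
  t≥1 = n≢0⇒n>0 (λ t≡0 → <⇒≱ j≥1 (≤-reflexive (trans j≡2Nt (trans (cong (2 * N *_) t≡0) (*-zeroʳ (2 * N))))))
  t<c : t < c
  t<c = *-cancelˡ-< (2 * N) t c (subst₂ _<_ j≡2Nt 2cN≡2Nc j<2cN)
  same-letter : P (shift (2 + k) f) t ≡ P (shift (2 + k) f) c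
  same-letter = begin
    P (shift (2 + k) f) t  ≡⟨ sym (P-2^k* (2 + k) f t≥1) ⟩
    P f (2 * N * t)        ≡⟨ cong (P f) (trans (sym j≡2Nt) (sym (+-identityʳ j))) ⟩
    P f (j + 0)            ≡⟨ agree 0 (≤-trans (s≤s z≤n) n≥7) ⟩
    P f (2 * c * N + 0)    ≡⟨ cong (P f) (trans (+-identityʳ (2 * c * N)) 2cN≡2Nc) ⟩
    P f (2 * N * c)        ≡⟨ P-2^k* (2 + k) f (≤-trans t≥1 (<⇒≤ t<c)) ⟩
    P (shift (2 + k) f) c  ∎
    where open ≡-Reasoning

appearance-lower : ∀ f k n c → 7 ≤ n → 2 ^ k < n → n ≤ 2 ^ suc k → 1 ≤ c → NewLetterAt (shift (2 + k) f) c →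
                   ∀ K → AllFactorsIn f n K → 2 * c * 2 ^ suc k + n ∸ 1 ≤ K
appearance-lower f k n c n≥7 2^k<n n≤N c≥1 new K all
  with all (2 * c * 2 ^ suc k) (*-mono-≤ {1} {2 * c} (*-mono-≤ {1} {2} (s≤s z≤n) c≥1) (m^n>0 2 (suc k)))
... | j , j≥1 , j+n∸1≤K , same with 2 * c * 2 ^ suc k ≤? j
...   | yes 2cN≤j = ≤-trans (∸-monoˡ-≤ 1 (+-monoˡ-≤ n 2cN≤j)) j+n∸1≤K
...   | no  2cN≰j = ⊥-elim (no-early-occurrence f k n c j n≥7 2^k<n n≤N new j≥1 (≰⇒> 2cN≰j) same)

appearance-distinct : ∀ f k n → 7 ≤ n → 2 ^ k < n → n ≤ 2 ^ suc k → ¬ f (2 + k) ≡ f (3 + k) →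
                      AppearanceIs f n (4 * 2 ^ suc k + n ∸ 1)
appearance-distinct f k n n≥7 2^k<n n≤N distinct =
  appearance-upper f k n 4 n≤N (everyLetterWithin (shift (suc k) f) 4 ≤-refl (inj₂ (≢⇒≡opposite g1≢g2))) ,
  appearance-lower f k n 2 n≥7 2^k<n n≤N (s≤s z≤n) (newLetterAt-2 (shift (2 + k) f) g′0≢g′1)
  where
  g1≢g2 : ¬ shift (suc k) f 1 ≡ shift (suc k) f 2
  g1≢g2 eq = distinct (trans (sym (shift-comm (suc k) f 1)) (trans eq (shift-comm (suc k) f 2)))
  g′0≢g′1 : ¬ shift (2 + k) f 0 ≡ shift (2 + k) f 1
  g′0≢g′1 eq = distinct (trans (sym (shift-comm (2 + k) f 0)) (trans eq (shift-comm (2 + k) f 1)))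

appearance-equal : ∀ f k n → 7 ≤ n → 2 ^ k < n → n ≤ 2 ^ suc k → f (2 + k) ≡ f (3 + k) →
                   AppearanceIs f n (6 * 2 ^ suc k + n ∸ 1)
appearance-equal f k n n≥7 2^k<n n≤N equal =
  appearance-upper f k n 6 n≤N (everyLetterWithin (shift (suc k) f) 6 (m≤m+n 4 2) (inj₁ ≤-refl)) ,
  appearance-lower f k n 3 n≥7 2^k<n n≤N (s≤s z≤n) (newLetterAt-3 (shift (2 + k) f) g′0≡g′1)
  where
  g′0≡g′1 : shift (2 + k) f 0 ≡ shift (2 + k) f 1
  g′0≡g′1 = trans (shift-comm (2 + k) f 0) (trans equal (sym (shift-comm (2 + k) f 1)))

appearance-unique : ∀ f n {K K′} → AppearanceIs f n K → AppearanceIs f n K′ → K ≡ K′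
appearance-unique f n (all , least) (all′ , least′) = ≤-antisym (least _ all′) (least′ _ all)

φ-search : ∀ fuel d j k n → j + d ≡ suc k → d ≤ fuel → 2 ^ k < n → n ≤ 2 ^ suc k →
           phiSearch fuel (2 ^ j) n ≡ 2 ^ suc k
φ-search zero       zero j k n j+0≡ _ _ _ = cong (2 ^_) (trans (sym (+-identityʳ j)) j+0≡)
φ-search (suc fuel) zero j k n j+0≡ _ _ n≤N rewrite trans (sym (+-identityʳ j)) j+0≡
  with n ≤ᵇ 2 ^ suc k in n≤ᵇN
... | true  = refl
... | false = ⊥-elim (subst T n≤ᵇN (≤⇒≤ᵇ n≤N))
φ-search (suc fuel) (suc d) j k n j+d≡ (s≤s d≤fuel) 2^k<n n≤N with n ≤ᵇ 2 ^ j in n≤ᵇ2^j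
... | true  = ⊥-elim (<⇒≱ 2^k<n (≤-trans (≤ᵇ⇒≤ n (2 ^ j) (subst T (sym n≤ᵇ2^j) tt)) (^-monoʳ-≤ 2 j≤k)))
  where
  j≤k : j ≤ k
  j≤k = subst (j ≤_) (suc-injective (trans (sym (+-suc j d)) j+d≡)) (m≤m+n j d)
... | false = φ-search fuel d (suc j) k n (trans (sym (+-suc j d)) j+d≡) d≤fuel 2^k<n n≤N

n<2^n : ∀ n → n < 2 ^ n
n<2^n zero    = s≤s z≤n
n<2^n (suc n) = subst (_≤ 2 ^ suc n) (cong suc (+-comm n 1))
                      (+-mono-≤ (n<2^n n) (≤-trans (m^n>0 2 n) (m≤m+n (2 ^ n) 0)))

φ-bracket : ∀ k n → 2 ^ k < n → n ≤ 2 ^ suc k → φ n ≡ 2 ^ suc k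
φ-bracket k n 2^k<n n≤N = φ-search n (suc k) 0 k n refl (≤-trans (n<2^n k) (<⇒≤ 2^k<n)) 2^k<n n≤N

2^k<2^[1+k] : ∀ k → 2 ^ k < 2 ^ suc k
2^k<2^[1+k] k = ^-monoʳ-< 2 (s≤s (s≤s z≤n)) (n<1+n k)

φ-2^ : ∀ k → φ (2 ^ suc k) ≡ 2 ^ suc k
φ-2^ k = φ-bracket k (2 ^ suc k) (2^k<2^[1+k] k) ≤-refl

power-bracket : ∀ n → 2 ≤ n → ∃ λ k → 2 ^ k < n × n ≤ 2 ^ suc k
power-bracket 1 (s≤s ())
power-bracket 2 _ = 0 , ≤-refl , ≤-refl
power-bracket (suc (suc (suc n))) _ with power-bracket (suc (suc n)) (s≤s (s≤s z≤n))
... | k , 2^k<n , n≤N with suc (suc (suc n)) ≤? 2 ^ suc k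
...   | yes n+1≤N = k , ≤-trans 2^k<n (n≤1+n _) , n+1≤N
...   | no  n+1≰N = suc k , ≰⇒> n+1≰N ,
          subst (_≤ 2 ^ suc (suc k)) (+-comm (suc (suc n)) 1)
                (+-mono-≤ n≤N (≤-trans (m^n>0 2 (suc k)) (m≤m+n (2 ^ suc k) 0)))

bracket-≥7 : ∀ n → 7 ≤ n → ∃ λ k → 2 ≤ k × 2 ^ k < n × n ≤ 2 ^ suc k
bracket-≥7 n n≥7 with power-bracket n (≤-trans (m≤m+n 2 5) n≥7)
... | 0 , _ , n≤2 = ⊥-elim (<⇒≱ (m≤m+n 3 4) (≤-trans n≥7 n≤2))
... | 1 , _ , n≤4 = ⊥-elim (<⇒≱ (m≤m+n 5 2) (≤-trans n≥7 n≤4))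
... | suc (suc k) , 2^k<n , n≤N = suc (suc k) , s≤s (s≤s z≤n) , 2^k<n , n≤N

4N≢6N : ∀ N x → 1 ≤ N → ¬ 4 * N + x ∸ 1 ≡ 6 * N + x ∸ 1
4N≢6N (suc N) x _ eq with *-cancelʳ-≡ 4 6 (suc N) (+-cancelʳ-≡ x (4 * suc N) (6 * suc N) (cong suc eq))
... | ()

7≤2^[1+k] : ∀ k → 2 ≤ k → 7 ≤ 2 ^ suc k
7≤2^[1+k] k k≥2 = ≤-trans (n≤1+n 7) (^-monoʳ-≤ 2 (s≤s k≥2))

appearance-at-2^ : ∀ f k c → 2 ≤ k → ((n : ℕ) → 7 ≤ n → AppearanceIs f n (c * φ n + n ∸ 1)) →
                   AppearanceIs f (2 ^ suc k) (c * 2 ^ suc k + 2 ^ suc k ∸ 1)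
appearance-at-2^ f k c k≥2 hyp =
  subst (λ x → AppearanceIs f (2 ^ suc k) (c * x + 2 ^ suc k ∸ 1)) (φ-2^ k) (hyp (2 ^ suc k) (7≤2^[1+k] k k≥2))

appearance-4⇔distinct : ∀ f → ((n : ℕ) → 7 ≤ n → AppearanceIs f n (4 * φ n + n ∸ 1))
                              ⇔ (∀ k → 2 ≤ k → ¬ f (2 + k) ≡ f (3 + k))
appearance-4⇔distinct f = mk⇔ distinct appearance
  where
  distinct : ((n : ℕ) → 7 ≤ n → AppearanceIs f n (4 * φ n + n ∸ 1)) → ∀ k → 2 ≤ k → ¬ f (2 + k) ≡ f (3 + k)
  distinct hyp k k≥2 equal = 4N≢6N N N (m^n>0 2 (suc k)) (appearance-unique f N
    (appearance-at-2^ f k 4 k≥2 hyp)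
    (appearance-equal f k N (7≤2^[1+k] k k≥2) (2^k<2^[1+k] k) ≤-refl equal))
    where N = 2 ^ suc k
  appearance : (∀ k → 2 ≤ k → ¬ f (2 + k) ≡ f (3 + k)) → (n : ℕ) → 7 ≤ n → AppearanceIs f n (4 * φ n + n ∸ 1)
  appearance distinct n n≥7 with bracket-≥7 n n≥7
  ... | k , k≥2 , 2^k<n , n≤N rewrite φ-bracket k n 2^k<n n≤N = appearance-distinct f k n n≥7 2^k<n n≤N (distinct k k≥2)

appearance-6⇔equal : ∀ f → ((n : ℕ) → 7 ≤ n → AppearanceIs f n (6 * φ n + n ∸ 1))
                           ⇔ (∀ k → 2 ≤ k → f (2 + k) ≡ f (3 + k))
appearance-6⇔equal f = mk⇔ equal appearance
  where
  equal : ((n : ℕ) → 7 ≤ n → AppearanceIs f n (6 * φ n + n ∸ 1)) → ∀ k → 2 ≤ k → f (2 + k) ≡ f (3 + k)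
  equal hyp k k≥2 with f (2 + k) ≟ˢ f (3 + k)
  ... | yes eq       = eq
  ... | no  distinct = ⊥-elim (4N≢6N N N (m^n>0 2 (suc k)) (appearance-unique f N
    (appearance-distinct f k N (7≤2^[1+k] k k≥2) (2^k<2^[1+k] k) ≤-refl distinct)
    (appearance-at-2^ f k 6 k≥2 hyp)))
    where N = 2 ^ suc k
  appearance : (∀ k → 2 ≤ k → f (2 + k) ≡ f (3 + k)) → (n : ℕ) → 7 ≤ n → AppearanceIs f n (6 * φ n + n ∸ 1)
  appearance equal n n≥7 with bracket-≥7 n n≥7
  ... | k , k≥2 , 2^k<n , n≤N rewrite φ-bracket k n 2^k<n n≤N = appearance-equal f k n n≥7 2^k<n n≤N (equal k k≥2)

alternating⇔distinct : (f : FoldingSeq) → ((i : ℕ) → 4 ≤ i → f (suc i) ≡ opposite (f i))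
                             ⇔ (∀ k → 2 ≤ k → ¬ f (2 + k) ≡ f (3 + k))
alternating⇔distinct f = mk⇔
  (λ alt k k≥2 equal → s≢opposite[s] (f (2 + k)) (trans equal (alt (2 + k) (s≤s (s≤s k≥2)))))
  (λ { distinct (suc (suc k)) (s≤s (s≤s k≥2)) → ≢⇒≡opposite (distinct k k≥2) })

constant-from : ∀ {A : Set} (g : ℕ → A) m → (∀ i → m ≤ i → g i ≡ g (suc i)) → ∀ i → m ≤ i → g i ≡ g m
constant-from g m step i m≤i = subst (λ x → g x ≡ g m) (m∸n+n≡m m≤i) (from-m (i ∸ m))
  where
  from-m : ∀ d → g (d + m) ≡ g m
  from-m zero    = refl
  from-m (suc d) = trans (sym (step (d + m) (m≤n+m m d))) (from-m d)

constant⇔equal : (f : FoldingSeq) → ((i : ℕ) → 4 ≤ i → f i ≡ f 4) ⇔ (∀ k → 2 ≤ k → f (2 + k) ≡ f (3 + k))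
constant⇔equal f = mk⇔
  (λ const k k≥2 → trans (const (2 + k) (s≤s (s≤s k≥2))) (sym (const (3 + k) (s≤s (s≤s (m≤n⇒m≤1+n k≥2))))))
  (λ equal → constant-from f 4 λ { (suc (suc k)) (s≤s (s≤s k≥2)) → equal k k≥2 })

corollary3p6 : (f : FoldingSeq) →
    (((n : ℕ) → 7 ≤ n → AppearanceIs f n (4 * φ n + n ∸ 1))
      ⇔ ((i : ℕ) → 4 ≤ i → f (suc i) ≡ opposite (f i)))
    × (((n : ℕ) → 7 ≤ n → AppearanceIs f n (6 * φ n + n ∸ 1))
      ⇔ ((i : ℕ) → 4 ≤ i → f i ≡ f 4))
corollary3p6 f = ⇔-sym (alternating⇔distinct f) ⇔-∘ appearance-4⇔distinct f
               , ⇔-sym (constant⇔equal f) ⇔-∘ appearance-6⇔equal f
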